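{- Each of the following holds. (i) Some $4$-connected planar triangulations are not $(2,1)$-decomposable. (ii) Some Hamiltonian planar triangulations are not $(2,2)$-decomposable. (iii) Some planar triangulations are not $(2,3)$-decomposable.
   Context: All graphs are finite, undirected and simple. A planar triangulation is a maximally planar graph. A graph $G=(V,E)$ is $4$-connected if $|V|\ge 5$ and for every triple $S$ of vertices the graph $G-S$ is connected. A Hamiltonian path in $G$ is a simple path in $G$ that contains all vertices of $G$, and $G$ is called Hamiltonian if it contains at least one Hamiltonian path. For positive integers $k,d$, a graph is $(k,d)$-decomposable if its edges decompose (that is, its edge set can be partitioned) into $k$ forests and one subgraph of maximum degree at most $d$. -}

module Defs where

open import Data.Bool using (Bool; T)
open import Data.Fin using (Fin; zero; suc)
open import Data.Fin.Subset using (Subset; ∣_∣; _∉_)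
open import Data.List using (List; _∷_; _∷ʳ_; length)
import Data.List.Membership.Propositional as List
open import Data.List.Relation.Unary.Linked using (Linked)
open import Data.List.Relation.Unary.Unique.Propositional using (Unique)
open import Data.Nat using (ℕ; suc; _+_; _*_; _≤_)
open import Data.Product using (∃; _×_; _,_; proj₁; proj₂)
open import Data.Vec using (tabulate)
open import Function using (_↔_; _⇔_; Inverse)
open import Function.Definitions using (StrictlySurjective)
open import Level using (0ℓ)
open import Relation.Binary using (Rel; Symmetric; Irreflexive)
open import Relation.Binary.Construct.Closure.ReflexiveTransitive using (Star)
open import Relation.Binary.PropositionalEquality using (_≡_; refl)
open import Relation.Nullary using (¬_)

record Graph (V : Set) : Set where
  infix 4 _~_
  field
    adj : V → V → Bool

  _~_ : Rel V 0ℓ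
  u ~ v = T (adj u v)

  field
    ~-sym    : Symmetric _~_
    ~-irrefl : Irreflexive _≡_ _~_

infix 4 _⊑_

-- Subgraph relation for spanning subgraphs.
_⊑_ : ∀ {V} → Graph V → Graph V → Set
G ⊑ H = ∀ u v → u G.~ v → u H.~ v
  where
  module G = Graph G
  module H = Graph H

Connected : ∀ {V} → Graph V → Set
Connected G = ∀ u v → Star (Graph._~_ G) u v

infixl 6 _-_

_-_ : ∀ {n} → Graph (Fin n) → (S : Subset n) → Graph (∃ λ v → v ∉ S)
G - S = record
  { adj      = λ u v → adj (proj₁ u) (proj₁ v)
  ; ~-sym    = ~-sym
  ; ~-irrefl = λ { refl → ~-irrefl refl }
  }
  where open Graph G

FourConnected : ∀ {n} → Graph (Fin n) → Set
FourConnected {n} G = 5 ≤ n × (∀ (S : Subset n) → ∣ S ∣ ≡ 3 → Connected (G - S))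

IsHamiltonianPath : ∀ {V} → Graph V → List V → Set
IsHamiltonianPath G vs = Linked (Graph._~_ G) vs × Unique vs × (∀ v → v List.∈ vs)

Hamiltonian : ∀ {V} → Graph V → Set
Hamiltonian G = ∃ λ vs → IsHamiltonianPath G vs

-- The cycle v, v₁, …, vₘ, v is given by v and vs = v₁ ∷ … ∷ vₘ.
IsCycle : ∀ {V} → Graph V → V → List V → Set
IsCycle G v vs = 2 ≤ length vs × Unique (v ∷ vs) × Linked (Graph._~_ G) ((v ∷ vs) ∷ʳ v)

Forest : ∀ {V} → Graph V → Set
Forest G = ∀ v vs → ¬ IsCycle G v vs

degree : ∀ {n} → Graph (Fin n) → Fin n → ℕ
degree G v = ∣ tabulate (Graph.adj G v) ∣

MaxDegree≤ : ∀ {n} → ℕ → Graph (Fin n) → Set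
MaxDegree≤ d G = ∀ v → degree G v ≤ d

-- Part zero is the subgraph of bounded degree; the other k parts are the
-- forests.  Parts may be edgeless.
record Decomposable {n} (k d : ℕ) (G : Graph (Fin n)) : Set where
  open Graph
  field
    part     : Fin (suc k) → Graph (Fin n)
    cover    : ∀ u v → _~_ G u v ⇔ ∃ λ i → _~_ (part i) u v
    disjoint : ∀ u v i j → _~_ (part i) u v → _~_ (part j) u v → i ≡ j
    forest   : ∀ i → Forest (part (suc i))
    bounded  : MaxDegree≤ d (part zero)

-- The equivalence relation _≈_ on A has exactly k classes.
HasClasses : ∀ {A : Set} → Rel A 0ℓ → ℕ → Set
HasClasses {A} _≈_ k = ∃ λ (class : A → Fin k) →
  StrictlySurjective _≡_ class × (∀ a b → class a ≡ class b ⇔ a ≈ b)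

-- Reachability under iteration of f; for a permutation f of a finite set this
-- is the equivalence relation "lies in the same cycle of f".
Orbit : ∀ {A : Set} → (A → A) → Rel A 0ℓ
Orbit f = Star (λ a b → f a ≡ b)

record Dart {V : Set} (G : Graph V) : Set where
  constructor dart
  open Graph G
  field
    src tgt : V
    src~tgt : src ~ tgt

rev : ∀ {V} {G : Graph V} → Dart G → Dart G
rev {G = G} (dart u v u~v) = dart v u (Graph.~-sym G u~v)

-- Combinatorial embeddings of G into closed orientable surfaces (one surface
-- for each component): a cyclic order of the darts leaving each vertex.
record RotationSystem {V : Set} (G : Graph V) : Set where
  open Dart
  field
    rotation : Dart G ↔ Dart G

  next : Dart G → Dart G
  next = Inverse.to rotation

  field
    next-src    : ∀ a → src (next a) ≡ src a
    next-cyclic : ∀ a b → src a ≡ src b → Orbit next a b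

  -- The boundary walks of the faces are the cycles of this permutation:
  -- traverse a, then continue with the dart that follows rev a around tgt a.
  face : Dart G → Dart G
  face a = next (rev a)

-- Planarity as the existence of a combinatorial embedding into spheres: by
-- Euler's formula, summed over the components, every surface of the embedding
-- is a sphere iff  V + F = E + 2 C.  All four numbers count classes of darts,
-- so isolated vertices, which do not affect planarity, contribute to none.
record Planar {V : Set} (G : Graph V) : Set where
  open Graph G
  open Dart
  field
    rotationSystem : RotationSystem G

  open RotationSystem rotationSystem public

  field
    #vertices #edges #faces #components : ℕ
    vertices   : HasClasses {Dart G} (λ a b → src a ≡ src b) #vertices
    edges      : HasClasses {Dart G} (Orbit rev) #edges
    faces      : HasClasses {Dart G} (Orbit face) #faces
    components : HasClasses {Dart G} (λ a b → Star _~_ (src a) (src b)) #components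
    euler      : #vertices + #faces ≡ #edges + 2 * #components

-- Maximal among the planar graphs on the same vertex set.
PlanarTriangulation : ∀ {V} → Graph V → Set
PlanarTriangulation {V} G = Planar G × (∀ (H : Graph V) → G ⊑ H → Planar H → H ⊑ G)

{-# OPTIONS --safe #-}

-- Let the first n of the N vertices of G meet every edge, and suppose that G splits into D of maximum
-- degree d and two forests.  Write e for the number of edges and eₙ for the number of those among the
-- first n vertices.  The degrees in D of the first n vertices count every edge of D once and those
-- among them twice, so e(D) + eₙ(D) ≤ dn, while each forest F has e(F) ≤ N − 1 and eₙ(F) ≤ n − 1.
-- If e(G) = 3N − 6 and eₙ(G) = 3n − 6, adding up gives N + n ≤ dn + 8.  This fails for the double
-- wheel with a rim of length 7 (N = n = 9, d = 1), for the one with a rim of length 9 and a vertex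
-- stacked into each face at one of the two hubs (n = 11, N = 20, d = 2), and for the one with a rim of
-- length 11 and a vertex stacked into every face (n = 13, N = 35, d = 3).
module Submission where

open import Defs
import Algebra.Properties.CommutativeMonoid.Sum as CommutativeMonoidSum
import Algebra.Properties.CommutativeSemigroup as CommutativeSemigroup
open import Data.Bool using (Bool; true; false; T?; if_then_else_)
open import Data.Bool.Properties using (T-irrelevant)
open import Data.Fin using (Fin; zero; suc; toℕ; fromℕ<; _<_; _<?_; _≟_; combine; remQuot; punchOut)
open import Data.Fin.Properties using (all?; any?; injective⇒≤; combine-injective; combine-remQuot; <-asym; <-cmp; <-irrefl; nonZeroIndex; punchOut-injective; toℕ-injective; toℕ-fromℕ<; toℕ<n)
open import Data.Fin.Subset using (Subset; inside; outside; ∣_∣; _∉_)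
import Data.Fin.Subset.Properties as Subset
open import Data.List using (List; []; _∷_; _++_; _∷ʳ_; map; mapMaybe; concatMap; filter; reverse; take; length; lookup; tabulate; allFin; upTo; downFrom; cartesianProduct)
import Data.List.Membership.DecPropositional as DecMembership
open import Data.List.Membership.Propositional using (_∈_; find)
open import Data.List.Membership.Propositional.Properties using (∈-lookup; ∈-filter⁺; ∈-filter⁻; ∈-cartesianProduct⁺; ∈-allFin)
open import Data.List.Properties using (length-++; filter-++)
open import Data.List.Relation.Unary.All as All using (All; []; _∷_)
open import Data.List.Relation.Unary.All.Properties using (all-filter; ¬Any⇒All¬; All¬⇒¬Any)
open import Data.List.Relation.Unary.AllPairs using ([]; _∷_)
open import Data.List.Relation.Unary.Any as Any using (Any; here; there)
open import Data.List.Relation.Unary.Any.Properties using (lookup-index)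
open import Data.List.Relation.Unary.Linked using (Linked; [-]; _∷_; linked?)
import Data.List.Relation.Unary.Unique.DecPropositional as DecUnique
open import Data.List.Relation.Unary.Unique.Propositional using (Unique)
import Data.List.Relation.Unary.Unique.Propositional.Properties as Unique
import Data.Maybe as Maybe
open import Data.Nat as ℕ using (ℕ; zero; suc; _+_; _*_; _∸_; _≤_; _≤ᵇ_; _≡ᵇ_; _%_; z≤n; s≤s; NonZero)
open import Data.Nat.DivMod using (_mod_; m<n⇒m%n≡m)
import Data.Nat.Properties as ℕ
open import Data.Nat.Tactic.RingSolver using (solve-∀)
open import Data.Product using (Σ; Σ-syntax; ∃; ∃₂; _×_; _,_; proj₁; proj₂; uncurry)
open import Data.Product.Properties using (≡-dec)
open import Data.Sum as Sum using (_⊎_; inj₁; inj₂)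
import Data.Vec as Vec
open import Data.Vec using ([]; _∷_)
open import Function using (_∘_; id; _⇔_; Equivalence; Injective; mk⇔; mk↔ₛ′)
open import Level using (0ℓ)
open import Relation.Binary using (Rel; DecidableEquality; tri<; tri≈; tri>)
open import Relation.Binary.Construct.Closure.ReflexiveTransitive as Star using (Star; ε; _◅_; _◅◅_)
open import Relation.Binary.PropositionalEquality using (_≡_; _≢_; refl; sym; trans; cong; cong₂; subst; module ≡-Reasoning)
open import Relation.Nullary using (¬_; Dec; yes; no; does; contradiction)
open import Relation.Nullary.Decidable using (_×-dec_; _⊎-dec_; _→-dec_; ¬?; ⌊_⌋; map′; from-yes; toWitness; fromWitness; dec⇒maybe)
open import Relation.Unary using (Pred; Decidable)

open CommutativeSemigroup ℕ.+-commutativeSemigroup using (interchange)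
open CommutativeMonoidSum ℕ.+-0-commutativeMonoid using (sum; sum-cong-≗; sum-replicate-zero; ∑-distrib-+; ∑-comm)

-- Planar graphs have at most 3n − 6 edges

lookup-injective : ∀ {A : Set} {xs : List A} → Unique xs → Injective _≡_ _≡_ (lookup xs)
lookup-injective (x≢xs ∷ _)  {zero}  {zero}  _  = refl
lookup-injective (x≢xs ∷ _)  {zero}  {suc j} eq = contradiction eq (All.lookup x≢xs (∈-lookup j))
lookup-injective (x≢xs ∷ _)  {suc i} {zero}  eq = contradiction (sym eq) (All.lookup x≢xs (∈-lookup i))
lookup-injective (_ ∷ xs!)   {suc i} {suc j} eq = cong suc (lookup-injective xs! eq)

-- The class of `a` is the position of `key a` in `keys`, a duplicate-free list of the values of
-- `key`. Edges and faces are counted this way, with the ends of a canonical dart as key.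
hasClasses : ∀ {A B : Set} {_≈_ : Rel A 0ℓ} (key : A → B) {keys : List B} → Unique keys →
             (∀ a → key a ∈ keys) → (∀ {b} → b ∈ keys → ∃ λ a → key a ≡ b) →
             (∀ a b → key a ≡ key b ⇔ a ≈ b) → HasClasses _≈_ (length keys)
hasClasses key {keys} keys! key∈keys hit key⇔≈ = class , surjective , λ a b →
  mk⇔ (λ eq → Equivalence.to (key⇔≈ a b)
         (trans (key≡lookup a) (trans (cong (lookup keys) eq) (sym (key≡lookup b)))))
      (λ a≈b → lookup-injective keys!
         (trans (sym (key≡lookup a)) (trans (Equivalence.from (key⇔≈ a b) a≈b) (key≡lookup b))))
  where
  class = λ a → Any.index (key∈keys a)
  key≡lookup : ∀ a → key a ≡ lookup keys (class a)
  key≡lookup a = lookup-index (key∈keys a)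
  surjective : ∀ i → ∃ λ a → class a ≡ i
  surjective i with hit (∈-lookup i)
  ... | a , eq = a , lookup-injective keys! (trans (sym (key≡lookup a)) eq)

module _ {V : Set} {G : Graph V} where
  open Graph G
  open Dart

  dart-≡ : {a b : Dart G} → src a ≡ src b → tgt a ≡ tgt b → a ≡ b
  dart-≡ {dart u v p} {dart _ _ q} refl refl = cong (dart u v) (T-irrelevant p q)

  rev-involutive : (a : Dart G) → rev (rev a) ≡ a
  rev-involutive a = dart-≡ refl refl

  orbit-rev : {a b : Dart G} → Orbit rev a b → b ≡ a ⊎ b ≡ rev a
  orbit-rev ε = inj₁ refl
  orbit-rev {a} (refl ◅ s) with orbit-rev s
  ... | inj₁ refl = inj₂ refl
  ... | inj₂ refl = inj₁ (rev-involutive a)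

  module _ (R : RotationSystem G) where
    open RotationSystem R

    src-face : ∀ a → src (face a) ≡ tgt a
    src-face a = next-src (rev a)

    face≢ : ∀ a → face a ≢ a
    face≢ a eq = ~-irrefl (trans (cong src (sym eq)) (src-face a)) (src~tgt a)

    -- The darts leaving a vertex form one orbit of `next`, so a fixed dart is alone there.
    fixed⇒leaf : ∀ {a b} → next a ≡ a → src b ≡ src a → b ≡ a
    fixed⇒leaf {a} fix src≡ = stays (next-cyclic a _ (sym src≡)) refl
      where
      stays : ∀ {c b} → Orbit next c b → c ≡ a → b ≡ a
      stays ε eq = eq
      stays (refl ◅ s) refl = stays s fix

    -- A face of length two would give `next (rev a) ≡ rev a`, making `tgt a` a leaf.
    face²≢ : (∀ v → ∃₂ λ x y → x ≢ y × v ~ x × v ~ y) → ∀ a → face (face a) ≢ a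
    face²≢ branching a eq with branching (tgt a)
    ... | x , y , x≢y , v~x , v~y = x≢y (cong tgt (trans (leaf (dart _ x v~x) refl) (sym (leaf (dart _ y v~y) refl))))
      where
      face≡rev : face a ≡ rev a
      face≡rev = dart-≡ (src-face a) (trans (sym (src-face (face a))) (cong src eq))
      leaf : ∀ b → src b ≡ tgt a → b ≡ rev a
      leaf b = fixed⇒leaf face≡rev

remQuot-injective : ∀ {m} k → Injective _≡_ _≡_ (remQuot {m} k)
remQuot-injective {m} k {i} {j} eq =
  trans (sym (combine-remQuot {m} k i)) (trans (cong (uncurry combine) eq) (combine-remQuot {m} k j))

module EdgeBound {n} {H : Graph (Fin n)} (P : Planar H) where
  open Graph H
  open Dart
  open Planar P

  side : Dart H → Fin 2
  side a with src a <? tgt a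
  ... | yes _ = zero
  ... | no  _ = suc zero

  side-rev : ∀ a → side (rev a) ≢ side a
  side-rev a with src a <? tgt a | tgt a <? src a
  ... | yes p | yes q = contradiction q (<-asym p)
  ... | yes _ | no  _ = λ ()
  ... | no  _ | yes _ = λ ()
  ... | no ¬p | no ¬q with <-cmp (src a) (tgt a)
  ...   | tri< p _ _ = contradiction p ¬p
  ...   | tri≈ _ p _ = contradiction (src~tgt a) (~-irrefl p)
  ...   | tri> _ _ p = contradiction p ¬q

  edge : Dart H → Fin #edges
  edge = proj₁ edges

  same-edge : ∀ {a b} → edge a ≡ edge b → b ≡ a ⊎ b ≡ rev a
  same-edge eq = orbit-rev (Equivalence.to (proj₂ (proj₂ edges) _ _) eq)

  -- An edge has at most two darts, told apart by whether they ascend in the order of `Fin n`.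
  dartCode : Dart H → Fin (#edges * 2)
  dartCode a = combine (edge a) (side a)

  dartCode-injective : Injective _≡_ _≡_ dartCode
  dartCode-injective {a} {b} eq with combine-injective (edge a) (side a) (edge b) (side b) eq
  ... | edge≡ , side≡ with same-edge edge≡
  ...   | inj₁ refl = refl
  ...   | inj₂ refl = contradiction (sym side≡) (side-rev a)

  faceRep : Fin #faces → Dart H
  faceRep f = proj₁ (proj₁ (proj₂ faces) f)

  turn : Fin 3 → Dart H → Dart H
  turn zero             a = a
  turn (suc zero)       a = face a
  turn (suc (suc zero)) a = face (face a)

  turn-orbit : ∀ i a → Orbit face a (turn i a)
  turn-orbit zero             a = ε
  turn-orbit (suc zero)       a = refl ◅ ε
  turn-orbit (suc (suc zero)) a = refl ◅ refl ◅ ε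

  class-turn : ∀ f i → proj₁ faces (turn i (faceRep f)) ≡ f
  class-turn f i = trans (sym (Equivalence.from (proj₂ (proj₂ faces) _ _) (turn-orbit i (faceRep f))))
                         (proj₂ (proj₁ (proj₂ faces) f))

  module _ (branching : ∀ v → ∃₂ λ x y → x ≢ y × v ~ x × v ~ y) where

    turn-injective : ∀ a → Injective _≡_ _≡_ (λ i → turn i a)
    turn-injective a {zero}         {zero}         _  = refl
    turn-injective a {suc zero}     {suc zero}     _  = refl
    turn-injective a {suc (suc zero)} {suc (suc zero)} _ = refl
    turn-injective a {zero}         {suc zero}     eq = contradiction (sym eq) (face≢ rotationSystem a)
    turn-injective a {suc zero}     {zero}         eq = contradiction eq (face≢ rotationSystem a)
    turn-injective a {zero}         {suc (suc zero)} eq = contradiction (sym eq) (face²≢ rotationSystem branching a)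
    turn-injective a {suc (suc zero)} {zero}       eq = contradiction eq (face²≢ rotationSystem branching a)
    turn-injective a {suc zero}     {suc (suc zero)} eq = contradiction (sym eq) (face≢ rotationSystem (face a))
    turn-injective a {suc (suc zero)} {suc zero}   eq = contradiction eq (face≢ rotationSystem (face a))

    corner : Fin #faces × Fin 3 → Dart H
    corner (f , i) = turn i (faceRep f)

    corner-injective : Injective _≡_ _≡_ corner
    corner-injective {f , i} {g , j} eq
      with refl ← trans (sym (class-turn f i)) (trans (cong (proj₁ faces) eq) (class-turn g j))
      = cong (f ,_) (turn-injective (faceRep f) eq)

    -- Double counting of darts: each face supplies three distinct ones, orbits of `face` of length
    -- one or two being excluded, and each edge has at most two.
    3faces≤2edges : #faces * 3 ≤ #edges * 2
    3faces≤2edges = injective⇒≤ {f = dartCode ∘ corner ∘ remQuot {#faces} 3}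
      (remQuot-injective {#faces} 3 ∘ corner-injective ∘ dartCode-injective)

  vertexRep : Fin #vertices → Dart H
  vertexRep v = proj₁ (proj₁ (proj₂ vertices) v)

  vertices≤ : #vertices ≤ n
  vertices≤ = injective⇒≤ {f = src ∘ vertexRep} λ {u} {v} eq →
    trans (sym (proj₂ (proj₁ (proj₂ vertices) u)))
      (trans (Equivalence.from (proj₂ (proj₂ vertices) _ _) eq) (proj₂ (proj₁ (proj₂ vertices) v)))

  module _ {es : List (Fin n × Fin n)} (es! : Unique es) (ok : All (λ (u , v) → u < v × u ~ v) es) where

    nthDart : Fin (length es) → Dart H
    nthDart i = dart _ _ (proj₂ (All.lookup ok (∈-lookup i)))

    nthDart-injective : Injective _≡_ _≡_ nthDart
    nthDart-injective eq = lookup-injective es! (cong₂ _,_ (cong src eq) (cong tgt eq))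

    -- Listed darts all ascend, so none is the reverse of another, and distinct ones lie on distinct
    -- edges.
    listed≤edges : length es ≤ #edges
    listed≤edges = injective⇒≤ {f = edge ∘ nthDart} λ {i} {j} eq → nthDart-injective (unoriented i j (same-edge eq))
      where
      unoriented : ∀ i j → nthDart j ≡ nthDart i ⊎ nthDart j ≡ rev (nthDart i) → nthDart i ≡ nthDart j
      unoriented i j (inj₁ eq) = sym eq
      unoriented i j (inj₂ eq) = contradiction
        (subst (λ d → src d < tgt d) eq (proj₁ (All.lookup ok (∈-lookup j))))
        (<-asym (proj₁ (All.lookup ok (∈-lookup i))))

  -- Three times Euler's formula reads 3V + 3F = 3E + 6C; the bounds on F, V and C then leave E + 6
  -- ≤ 3n. `V` counts only vertices that have darts, whence an inequality with `n`.
  euler-bound : ∀ V F E C → V + F ≡ E + 2 * C → F * 3 ≤ E * 2 → V ≤ n → 1 ≤ C → E + 6 ≤ 3 * n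
  euler-bound V F E C eq 3F≤2E V≤n 1≤C = ℕ.+-cancelˡ-≤ (E * 2) _ _ (begin
    E * 2 + (E + 6)       ≤⟨ ℕ.+-monoʳ-≤ (E * 2) (ℕ.+-monoʳ-≤ E (ℕ.*-monoʳ-≤ 6 1≤C)) ⟩
    E * 2 + (E + 6 * C)   ≡⟨ lhs E C ⟩
    3 * (E + 2 * C)       ≡⟨ cong (3 *_) (sym eq) ⟩
    3 * (V + F)           ≡⟨ rhs V F ⟩
    F * 3 + 3 * V         ≤⟨ ℕ.+-mono-≤ 3F≤2E (ℕ.*-monoʳ-≤ 3 V≤n) ⟩
    E * 2 + 3 * n         ∎)
    where
    open ℕ.≤-Reasoning
    lhs : ∀ E C → E * 2 + (E + 6 * C) ≡ 3 * (E + 2 * C)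
    lhs = solve-∀
    rhs : ∀ V F → 3 * (V + F) ≡ F * 3 + 3 * V
    rhs = solve-∀

  planar-edge-bound : ∀ {es} → Fin n → (∀ v → ∃₂ λ x y → x ≢ y × v ~ x × v ~ y) →
                      Unique es → All (λ (u , v) → u < v × u ~ v) es → length es + 6 ≤ 3 * n
  planar-edge-bound v₀ branching es! ok = ℕ.≤-trans (ℕ.+-monoˡ-≤ 6 (listed≤edges es! ok))
    (euler-bound #vertices #faces #edges #components euler (3faces≤2edges branching) vertices≤ 1≤components)
    where
    1≤components : 1 ≤ #components
    1≤components with branching v₀
    ... | x , _ , _ , v~x , _ = ℕ.>-nonZero⁻¹ #components {{nonZeroIndex (proj₁ components (dart v₀ x v~x))}}

-- Forests

-- The list holds all visited vertices, both ends included, so that a walk closed by one more edge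
-- has the shape required by `IsCycle`.
data Walk {A : Set} (R : Rel A 0ℓ) : A → A → List A → Set where
  stop : ∀ {a} → Walk R a a (a ∷ [])
  step : ∀ {a b c xs} → R a b → Walk R b c xs → Walk R a c (a ∷ xs)

module _ {A : Set} {R : Rel A 0ℓ} where

  suffix : ∀ {a b c xs} → Walk R b c xs → Unique xs → a ∈ xs → ∃ λ ys → Walk R a c ys × Unique ys
  suffix w@stop       xs! (here refl) = _ , w , xs!
  suffix w@(step _ _) xs! (here refl) = _ , w , xs!
  suffix (step _ w) (_ ∷ xs!) (there a∈xs) = suffix w xs! a∈xs

  -- Loop erasure: if `a` already occurs on the simple walk from the next vertex, only the part from
  -- `a` on is kept.
  simpleWalk : DecidableEquality A → ∀ {a c} → Star R a c → ∃ λ xs → Walk R a c xs × Unique xs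
  simpleWalk _≟_ ε = _ , stop , [] ∷ []
  simpleWalk _≟_ {a} (r ◅ s) with simpleWalk _≟_ s
  ... | xs , w , xs! with Any.any? (a ≟_) xs
  ...   | yes a∈xs = suffix w xs! a∈xs
  ...   | no  a∉xs = a ∷ xs , step r w , ¬Any⇒All¬ xs a∉xs ∷ xs!

  closeWalk : ∀ {a c d xs} → Walk R a c xs → R c d → Linked R (xs ∷ʳ d)
  closeWalk stop r = r ∷ [-]
  closeWalk (step r stop) r′ = r ∷ closeWalk stop r′
  closeWalk (step r w@(step _ _)) r′ = r ∷ closeWalk w r′

  mapWalk : ∀ {S : Rel A 0ℓ} → (∀ {a b} → R a b → S a b) → ∀ {a c xs} → Walk R a c xs → Walk S a c xs
  mapWalk f stop = stop
  mapWalk f (step r w) = step (f r) (mapWalk f w)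

module _ {k : ℕ} {i j : Fin (suc k)} (j≢i : j ≢ i) where

  -- Identifies `j` with `i`: `punchOut` renumbers the classes other than `j`, and `j` takes the new
  -- number of `i`.
  merge : Fin (suc k) → Fin k
  merge x with j ≟ x
  ... | yes _  = punchOut j≢i
  ... | no j≢x = punchOut j≢x

  merge-≡ : ∀ {x y} → merge x ≡ merge y → x ≡ y ⊎ (x ≡ i × y ≡ j) ⊎ (x ≡ j × y ≡ i)
  merge-≡ {x} {y} eq with j ≟ x | j ≟ y
  ... | yes refl | yes refl = inj₁ refl
  ... | yes refl | no  j≢y  = inj₂ (inj₂ (refl , sym (punchOut-injective j≢i j≢y eq)))
  ... | no  j≢x  | yes refl = inj₂ (inj₁ (punchOut-injective j≢x j≢i eq , refl))
  ... | no  j≢x  | no  j≢y  = inj₁ (punchOut-injective j≢x j≢y eq)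

module _ {N : ℕ} where

  Edge : Set
  Edge = Fin N × Fin N

  Joined : List Edge → Rel (Fin N) 0ℓ
  Joined es u v = (u , v) ∈ es ⊎ (v , u) ∈ es

  -- The edges of H on the first m vertices, each in increasing orientation.
  EdgeBelow : Graph (Fin N) → ℕ → Edge → Set
  EdgeBelow H m (u , v) = u < v × toℕ v ℕ.< m × Graph._~_ H u v

  module _ {H : Graph (Fin N)} (acyclic : Forest H) where
    open Graph H

    joined⇒~ : ∀ {m es} → All (EdgeBelow H m) es → ∀ {u v} → Joined es u v → u ~ v
    joined⇒~ ok (inj₁ uv) = proj₂ (proj₂ (All.lookup ok uv))
    joined⇒~ ok (inj₂ vu) = ~-sym (proj₂ (proj₂ (All.lookup ok vu)))

    -- Such a walk, made simple, would close up to a cycle with the edge from `v` to `u`. It has at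
    -- least two steps because `u < v`, the pair does not recur in `es`, and listed pairs ascend.
    newEdge-bridges : ∀ {m u v es} → Unique ((u , v) ∷ es) → All (EdgeBelow H m) ((u , v) ∷ es) →
                      ¬ Star (Joined es) u v
    newEdge-bridges {u = u} {v} (uv∉es ∷ _) ((u<v , _ , u~v) ∷ ok) u→v
      with simpleWalk _≟_ u→v
    ... | _ , stop , _ = <-irrefl refl u<v
    ... | _ , step (inj₁ uv∈es) stop , _ = All¬⇒¬Any uv∉es uv∈es
    ... | _ , step (inj₂ vu∈es) stop , _ = <-asym u<v (proj₁ (All.lookup ok vu∈es))
    -- This case and the next differ only in whether the walk stops at its third vertex; the match
    -- exposes the three list entries needed for the length condition of `IsCycle`.
    ... | _ , w@(step _ (step _ stop)) , xs! =
      acyclic _ _ (s≤s (s≤s z≤n) , xs! , closeWalk (mapWalk (joined⇒~ ok) w) (~-sym u~v))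
    ... | _ , w@(step _ (step _ (step _ _))) , xs! =
      acyclic _ _ (s≤s (s≤s z≤n) , xs! , closeWalk (mapWalk (joined⇒~ ok) w) (~-sym u~v))

    -- Union-find along the edge list: from `m` singleton classes, each edge merges two classes,
    -- which are distinct by `newEdge-bridges`. Hence `m` minus the number of edges labels remain.
    components : ∀ m .{{_ : NonZero m}} {es} → Unique es → All (EdgeBelow H m) es →
                 ∃ λ k → k + length es ≡ m × Σ (Fin N → Fin k) λ class →
                 ∀ u v → toℕ u ℕ.< m → toℕ v ℕ.< m → class u ≡ class v → Star (Joined es) u v
    -- On the first `m` vertices `mod` is the identity; beyond them it merely makes the labelling
    -- total.
    components m [] [] = m , ℕ.+-identityʳ m , (λ u → toℕ u mod m) , separated
      where
      toℕ-mod : ∀ {x} → x ℕ.< m → toℕ (x mod m) ≡ x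
      toℕ-mod x<m = trans (toℕ-fromℕ< _) (m<n⇒m%n≡m x<m)
      separated : ∀ u v → toℕ u ℕ.< m → toℕ v ℕ.< m → toℕ u mod m ≡ toℕ v mod m → Star (Joined []) u v
      separated u v u<m v<m eq with refl ← toℕ-injective {i = u} {v}
        (trans (sym (toℕ-mod u<m)) (trans (cong toℕ eq) (toℕ-mod v<m))) = ε
    components m {(u , v) ∷ es} es!@(_ ∷ tail!) ok@((u<v , v<m , _) ∷ tailOk) with components m tail! tailOk
    ... | zero  , _   , class , _ with () ← class u
    ... | suc k , k+e , class , connected =
      k , trans (ℕ.+-suc k _) k+e , merge v≢u ∘ class , λ x y x<m y<m eq → join x<m y<m (merge-≡ v≢u eq)
      where
      u<m : toℕ u ℕ.< m
      u<m = ℕ.<-trans u<v v<m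
      v≢u : class v ≢ class u
      v≢u eq = newEdge-bridges es! ok (connected u v u<m v<m (sym eq))
      old : ∀ {x y} → toℕ x ℕ.< m → toℕ y ℕ.< m → class x ≡ class y → Star (Joined ((u , v) ∷ es)) x y
      old x<m y<m eq = Star.map (Sum.map there there) (connected _ _ x<m y<m eq)
      join : ∀ {x y} → toℕ x ℕ.< m → toℕ y ℕ.< m →
             class x ≡ class y ⊎ (class x ≡ class u × class y ≡ class v) ⊎ (class x ≡ class v × class y ≡ class u) →
             Star (Joined ((u , v) ∷ es)) x y
      join x<m y<m (inj₁ eq) = old x<m y<m eq
      join x<m y<m (inj₂ (inj₁ (xu , yv))) = old x<m u<m xu ◅◅ inj₁ (here refl) ◅ old v<m y<m (sym yv)
      join x<m y<m (inj₂ (inj₂ (xv , yu))) = old x<m v<m xv ◅◅ inj₂ (here refl) ◅ old u<m y<m (sym yu)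

    -- The label of `v₀` shows that at least one class remains after all merges.
    forest-bound : Fin N → ∀ m .{{_ : NonZero m}} {es} → Unique es → All (EdgeBelow H m) es → length es ℕ.< m
    forest-bound v₀ m {es} es! ok with components m es! ok
    ... | zero  , _  , class , _ with () ← class v₀
    ... | suc k , eq , _ = subst (length es ℕ.<_) eq (s≤s (ℕ.m≤n+m (length es) k))

-- Counting edges

⟦_⟧ : ∀ {P : Set} → Dec P → ℕ
⟦ P? ⟧ = if does P? then 1 else 0

⟦⟧-≤ : ∀ {P Q : Set} (P? : Dec P) (Q? : Dec Q) → (P → Q) → ⟦ P? ⟧ ≤ ⟦ Q? ⟧
⟦⟧-≤ (no _)  _      f = z≤n
⟦⟧-≤ (yes p) (yes _) f = s≤s z≤n
⟦⟧-≤ (yes p) (no ¬q) f = contradiction (f p) ¬q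

⟦⟧-disjoint : ∀ {P Q R : Set} (P? : Dec P) (Q? : Dec Q) (R? : Dec R) →
              (P → R) → (Q → R) → (P → ¬ Q) → ⟦ P? ⟧ + ⟦ Q? ⟧ ≤ ⟦ R? ⟧
⟦⟧-disjoint (no _)  Q?      R? f g h = ⟦⟧-≤ Q? R? g
⟦⟧-disjoint (yes p) (yes q) R? f g h = contradiction q (h p)
⟦⟧-disjoint (yes p) (no _)  R? f g h = ⟦⟧-≤ (yes p) R? f

⟦⟧-⊎ : ∀ {P Q R : Set} (P? : Dec P) (Q? : Dec Q) (R? : Dec R) → (P → Q ⊎ R) → ⟦ P? ⟧ ≤ ⟦ Q? ⟧ + ⟦ R? ⟧
⟦⟧-⊎ (no _)  Q?      R? f = z≤n
⟦⟧-⊎ (yes p) (yes q) R? f = s≤s z≤n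
⟦⟧-⊎ (yes p) (no ¬q) R? f with f p
... | inj₁ q = contradiction q ¬q
... | inj₂ r = ⟦⟧-≤ (yes p) R? (λ _ → r)

sum-mono-≤ : ∀ {n} {f g : Fin n → ℕ} → (∀ i → f i ≤ g i) → sum f ≤ sum g
sum-mono-≤ {zero}  f≤g = z≤n
sum-mono-≤ {suc n} f≤g = ℕ.+-mono-≤ (f≤g zero) (sum-mono-≤ (f≤g ∘ suc))

length-filter-tabulate : ∀ {A : Set} {n} {P : Pred A 0ℓ} (P? : Decidable P) (f : Fin n → A) →
                         length (filter P? (tabulate f)) ≡ sum (λ i → ⟦ P? (f i) ⟧)
length-filter-tabulate {n = zero}  P? f = refl
length-filter-tabulate {n = suc n} P? f with does (P? (f zero))
... | true  = cong suc (length-filter-tabulate P? (f ∘ suc))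
... | false = length-filter-tabulate P? (f ∘ suc)

length-filter-map : ∀ {A B : Set} {P : Pred B 0ℓ} (P? : Decidable P) (f : A → B) xs →
                    length (filter P? (map f xs)) ≡ length (filter (P? ∘ f) xs)
length-filter-map P? f [] = refl
length-filter-map P? f (x ∷ xs) with does (P? (f x))
... | true  = cong suc (length-filter-map P? f xs)
... | false = length-filter-map P? f xs

length-filter-pairs : ∀ {A : Set} {m n} {P : Pred (A × Fin n) 0ℓ} (P? : Decidable P) (f : Fin m → A) →
                      length (filter P? (cartesianProduct (tabulate f) (allFin n))) ≡
                      sum (λ i → sum (λ j → ⟦ P? (f i , j) ⟧))
length-filter-pairs {m = zero}  P? f = refl
length-filter-pairs {m = suc m} {n} P? f = begin
  length (filter P? (row ++ rest))                     ≡⟨ cong length (filter-++ P? row rest) ⟩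
  length (filter P? row ++ filter P? rest)             ≡⟨ length-++ (filter P? row) ⟩
  length (filter P? row) + length (filter P? rest)     ≡⟨ cong₂ _+_ firstRow (length-filter-pairs P? (f ∘ suc)) ⟩
  sum (λ j → ⟦ P? (f zero , j) ⟧) + sum (λ i → sum (λ j → ⟦ P? (f (suc i) , j) ⟧)) ∎
  where
  open ≡-Reasoning
  row  = map (f zero ,_) (allFin n)
  rest = cartesianProduct (tabulate (f ∘ suc)) (allFin n)
  firstRow : length (filter P? row) ≡ sum (λ j → ⟦ P? (f zero , j) ⟧)
  firstRow = trans (length-filter-map P? (f zero ,_) (allFin n)) (length-filter-tabulate (P? ∘ (f zero ,_)) id)

length-filter-∷ : ∀ {A : Set} {P : Pred A 0ℓ} (P? : Decidable P) x xs →
                  length (filter P? (x ∷ xs)) ≡ ⟦ P? x ⟧ + length (filter P? xs)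
length-filter-∷ P? x xs with does (P? x)
... | true  = refl
... | false = refl

length-filter-⊎ : ∀ {A : Set} {P Q R : Pred A 0ℓ} (P? : Decidable P) (Q? : Decidable Q) (R? : Decidable R) →
                  (∀ {x} → P x → Q x ⊎ R x) → ∀ xs →
                  length (filter P? xs) ≤ length (filter Q? xs) + length (filter R? xs)
length-filter-⊎ P? Q? R? cover [] = z≤n
length-filter-⊎ P? Q? R? cover (x ∷ xs) = begin
  length (filter P? (x ∷ xs))
    ≡⟨ length-filter-∷ P? x xs ⟩
  ⟦ P? x ⟧ + length (filter P? xs)
    ≤⟨ ℕ.+-mono-≤ (⟦⟧-⊎ (P? x) (Q? x) (R? x) cover) (length-filter-⊎ P? Q? R? cover xs) ⟩
  (⟦ Q? x ⟧ + ⟦ R? x ⟧) + (length (filter Q? xs) + length (filter R? xs))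
    ≡⟨ interchange ⟦ Q? x ⟧ _ _ _ ⟩
  (⟦ Q? x ⟧ + length (filter Q? xs)) + (⟦ R? x ⟧ + length (filter R? xs))
    ≡⟨ cong₂ _+_ (length-filter-∷ Q? x xs) (length-filter-∷ R? x xs) ⟨
  length (filter Q? (x ∷ xs)) + length (filter R? (x ∷ xs)) ∎
  where open ℕ.≤-Reasoning

allPairs : ∀ N → List (Fin N × Fin N)
allPairs N = cartesianProduct (allFin N) (allFin N)

allPairs! : ∀ N → Unique (allPairs N)
allPairs! N = Unique.cartesianProduct⁺ (Unique.allFin⁺ N) (Unique.allFin⁺ N)

∈-allPairs : ∀ {N} (e : Fin N × Fin N) → e ∈ allPairs N
∈-allPairs (u , v) = ∈-cartesianProduct⁺ (∈-allFin u) (∈-allFin v)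

∣tabulate∣ : ∀ {n} (f : Fin n → Bool) → ∣ Vec.tabulate f ∣ ≡ sum (λ i → ⟦ T? (f i) ⟧)
∣tabulate∣ {zero}  f = refl
∣tabulate∣ {suc n} f with f zero
... | true  = cong suc (∣tabulate∣ (f ∘ suc))
... | false = ∣tabulate∣ (f ∘ suc)

module _ {N} (H : Graph (Fin N)) where
  open Graph H

  edgeBelow? : ∀ m → Decidable (EdgeBelow H m)
  edgeBelow? m (u , v) = (u <? v) ×-dec (toℕ v ℕ.<? m) ×-dec T? (adj u v)

  edgesBelow : ℕ → List (Fin N × Fin N)
  edgesBelow m = filter (edgeBelow? m) (allPairs N)

  edgesBelow! : ∀ m → Unique (edgesBelow m)
  edgesBelow! m = Unique.filter⁺ (edgeBelow? m) (allPairs! N)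

  edgesBelow-ok : ∀ m → All (EdgeBelow H m) (edgesBelow m)
  edgesBelow-ok m = all-filter (edgeBelow? m) (allPairs N)

  edges-forest : Forest H → Fin N → ∀ m .{{_ : NonZero m}} → length (edgesBelow m) ℕ.< m
  edges-forest acyclic v₀ m = forest-bound {H = H} acyclic v₀ m (edgesBelow! m) (edgesBelow-ok m)

  edges≡∑ : ∀ m → length (edgesBelow m) ≡ sum (λ u → sum (λ v → ⟦ edgeBelow? m (u , v) ⟧))
  edges≡∑ m = length-filter-pairs (edgeBelow? m) id

  -- The degrees of the first n vertices count every edge once and those among them twice.
  edges≤degrees : ∀ {d} n → (∀ {u v} → u < v → u ~ v → toℕ u ℕ.< n) → MaxDegree≤ d H →
                  length (edgesBelow N) + length (edgesBelow n) ≤ n * d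
  edges≤degrees {d} n covered bounded = begin
    length (edgesBelow N) + length (edgesBelow n)
      -- The second sum is transposed, so that row `u` collects edges to larger neighbours in one
      -- term and edges to smaller neighbours in the other. These are disjoint, so together they are
      -- at most the degree of `u`.
      ≡⟨ cong₂ _+_ (edges≡∑ N) (trans (edges≡∑ n) (∑-comm {N} {N} (λ u v → ⟦ edgeBelow? n (u , v) ⟧))) ⟩
    sum (λ u → sum (λ v → ⟦ edgeBelow? N (u , v) ⟧)) + sum (λ u → sum (λ v → ⟦ edgeBelow? n (v , u) ⟧))
      ≡⟨ ∑-distrib-+ {N} _ _ ⟨
    sum (λ u → sum (λ v → ⟦ edgeBelow? N (u , v) ⟧) + sum (λ v → ⟦ edgeBelow? n (v , u) ⟧))
      ≡⟨ sum-cong-≗ {N} (λ u → sym (∑-distrib-+ {N} _ _)) ⟩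
    sum (λ u → sum (λ v → ⟦ edgeBelow? N (u , v) ⟧ + ⟦ edgeBelow? n (v , u) ⟧))
      ≤⟨ sum-mono-≤ (λ u → ℕ.≤-trans (sum-mono-≤ (λ v → pair u v)) (row u (toℕ u ℕ.<? n))) ⟩
    sum {N} (λ u → if does (toℕ u ℕ.<? n) then d else 0)
      ≤⟨ block N n ⟩
    n * d ∎
    where
    open ℕ.≤-Reasoning
    atBase? : ∀ u v → Dec (toℕ u ℕ.< n × u ~ v)
    atBase? u v = (toℕ u ℕ.<? n) ×-dec T? (adj u v)
    pair : ∀ u v → ⟦ edgeBelow? N (u , v) ⟧ + ⟦ edgeBelow? n (v , u) ⟧ ≤ ⟦ atBase? u v ⟧
    pair u v = ⟦⟧-disjoint (edgeBelow? N (u , v)) (edgeBelow? n (v , u)) (atBase? u v)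
      (λ (u<v , _ , u~v) → covered u<v u~v , u~v)
      (λ (_ , u<n , v~u) → u<n , ~-sym v~u)
      (λ (u<v , _) (v<u , _) → <-asym u<v v<u)
    row : ∀ u {P : Set} (P? : Dec P) → sum (λ v → ⟦ P? ×-dec T? (adj u v) ⟧) ≤ (if does P? then d else 0)
    row u (yes _) = ℕ.≤-trans (ℕ.≤-reflexive (sym (∣tabulate∣ (adj u)))) (bounded u)
    row u (no _)  = ℕ.≤-reflexive (sum-replicate-zero N)
    block : ∀ N n → sum {N} (λ u → if does (toℕ u ℕ.<? n) then d else 0) ≤ n * d
    block zero    n       = z≤n
    block (suc N) zero    = block N zero
    block (suc N) (suc n) = ℕ.+-monoʳ-≤ d (block N n)

module _ {N} {G : Graph (Fin N)} where
  open Graph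

  edges-⊎ : ∀ {A B C : Graph (Fin N)} →
            (∀ {u v} → _~_ G u v → _~_ A u v ⊎ _~_ B u v ⊎ _~_ C u v) → ∀ m →
            length (edgesBelow G m) ≤ length (edgesBelow A m) + (length (edgesBelow B m) + length (edgesBelow C m))
  edges-⊎ {A} {B} {C} cover m = ℕ.≤-trans
    (length-filter-⊎ (edgeBelow? G m) (edgeBelow? A m) bc? split (allPairs N))
    (ℕ.+-monoʳ-≤ _ (length-filter-⊎ bc? (edgeBelow? B m) (edgeBelow? C m) id (allPairs N)))
    where
    bc? : Decidable (λ e → EdgeBelow B m e ⊎ EdgeBelow C m e)
    bc? e = edgeBelow? B m e ⊎-dec edgeBelow? C m e
    split : ∀ {e} → EdgeBelow G m e → EdgeBelow A m e ⊎ EdgeBelow B m e ⊎ EdgeBelow C m e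
    split (u<v , v<m , u~v) = Sum.map below (Sum.map below below) (cover u~v)
      where
      below : ∀ {P : Set} → P → _ × _ × P
      below p = u<v , v<m , p

  -- The strict inequality contradicts the sum of `edges≤degrees` for the part of bounded degree and
  -- four forest bounds: two forests, each on all vertices and on the first `n`. Each forest bound
  -- contributes one unit to the 4.
  indecomposable : ∀ {d} n .{{_ : NonZero n}} → Fin N → (∀ {u v} → u < v → _~_ G u v → toℕ u ℕ.< n) →
                   n * d + (n + n + (N + N)) ℕ.< 4 + (length (edgesBelow G N) + length (edgesBelow G n)) →
                   ¬ Decomposable 2 d G
  indecomposable {d} n v₀ covered many D = ℕ.<-irrefl refl (begin-strict
    n * d + (n + n + (N + N))                                  <⟨ many ⟩
    4 + (e G N + e G n)                                        ≤⟨ ℕ.+-monoʳ-≤ 4 (ℕ.+-mono-≤ (cover≤ N) (cover≤ n)) ⟩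
    4 + (e D₀ N + (e F₁ N + e F₂ N) + (e D₀ n + (e F₁ n + e F₂ n)))
      ≡⟨ rearrange (e D₀ N) (e F₁ N) (e F₂ N) (e D₀ n) (e F₁ n) (e F₂ n) ⟩
    (e D₀ N + e D₀ n) + (suc (e F₁ n) + suc (e F₂ n) + (suc (e F₁ N) + suc (e F₂ N)))
      ≤⟨ ℕ.+-mono-≤ (edges≤degrees D₀ n (λ u<v u~v → covered u<v (Equivalence.from (cover _ _) (zero , u~v))) bounded)
           (ℕ.+-mono-≤ (ℕ.+-mono-≤ (tree zero n) (tree (suc zero) n)) (ℕ.+-mono-≤ (tree zero N) (tree (suc zero) N))) ⟩
    n * d + (n + n + (N + N))                                  ∎)
    where
    open ℕ.≤-Reasoning
    open Decomposable D
    instance N≢0 : NonZero N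
    N≢0 = nonZeroIndex v₀
    e : Graph (Fin N) → ℕ → ℕ
    e H m = length (edgesBelow H m)
    D₀ = part zero
    F₁ = part (suc zero)
    F₂ = part (suc (suc zero))
    split : ∀ {u v} → _~_ G u v → _~_ D₀ u v ⊎ _~_ F₁ u v ⊎ _~_ F₂ u v
    split {u} {v} u~v with Equivalence.to (cover u v) u~v
    ... | zero , p             = inj₁ p
    ... | suc zero , p         = inj₂ (inj₁ p)
    ... | suc (suc zero) , p   = inj₂ (inj₂ p)
    cover≤ : ∀ m → e G m ≤ e D₀ m + (e F₁ m + e F₂ m)
    cover≤ = edges-⊎ {A = D₀} {F₁} {F₂} split
    tree : ∀ i m .{{_ : NonZero m}} → suc (e (part (suc i)) m) ≤ m
    tree i m = edges-forest (part (suc i)) (forest i) v₀ m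
    rearrange : ∀ a b c a′ b′ c′ → 4 + (a + (b + c) + (a′ + (b′ + c′))) ≡
                                   (a + a′) + (suc b′ + suc c′ + (suc b + suc c))
    rearrange = solve-∀

-- Triangulations from rotation systems

module _ {n} {G : Graph (Fin n)} where
  open Graph G
  open Dart

  ends : Dart G → Fin n × Fin n
  ends a = src a , tgt a

  ends-injective : ∀ {a b} → ends a ≡ ends b → a ≡ b
  ends-injective eq = dart-≡ (cong proj₁ eq) (cong proj₂ eq)

  -- The ascending direction is a common key of a dart and its reverse, and these keys are the
  -- entries of `edgesBelow G n`.
  oriented : Dart G → Fin n × Fin n
  oriented a with src a <? tgt a
  ... | yes _ = src a , tgt a
  ... | no  _ = tgt a , src a

  oriented-edge : ∀ a → oriented a ∈ edgesBelow G n
  oriented-edge a with src a <? tgt a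
  ... | yes u<v = ∈-filter⁺ (edgeBelow? G n) (∈-allPairs _) (u<v , toℕ<n _ , src~tgt a)
  ... | no  u≮v with <-cmp (src a) (tgt a)
  ...   | tri< u<v _ _ = contradiction u<v u≮v
  ...   | tri≈ _ u≡v _ = contradiction (src~tgt a) (~-irrefl u≡v)
  ...   | tri> _ _ v<u = ∈-filter⁺ (edgeBelow? G n) (∈-allPairs _) (v<u , toℕ<n _ , ~-sym (src~tgt a))

  oriented-increasing : ∀ a → src a < tgt a → oriented a ≡ ends a
  oriented-increasing a u<v with src a <? tgt a
  ... | yes _   = refl
  ... | no  u≮v = contradiction u<v u≮v

  oriented-rev : ∀ a → oriented (rev a) ≡ oriented a
  oriented-rev a with src a <? tgt a | tgt a <? src a | <-cmp (src a) (tgt a)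
  ... | yes _   | no _    | _            = refl
  ... | no _    | yes _   | _            = refl
  ... | _       | yes v<u | tri< _ _ v≮u = contradiction v<u v≮u
  ... | yes u<v | _       | tri> u≮v _ _ = contradiction u<v u≮v
  ... | no u≮v  | no _    | tri< u<v _ _ = contradiction u<v u≮v
  ... | no _    | no v≮u  | tri> _ _ v<u = contradiction v<u v≮u
  ... | _       | _       | tri≈ _ u≡v _ = contradiction (src~tgt a) (~-irrefl u≡v)

  oriented-ends : ∀ a → oriented a ≡ ends a ⊎ oriented a ≡ ends (rev a)
  oriented-ends a with src a <? tgt a
  ... | yes _ = inj₁ refl
  ... | no  _ = inj₂ refl

  orbit⇒oriented : ∀ {a b} → Orbit rev a b → oriented a ≡ oriented b
  orbit⇒oriented ε = refl
  orbit⇒oriented {a} (refl ◅ s) = trans (sym (oriented-rev a)) (orbit⇒oriented s)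

  oriented⇒orbit : ∀ a b → oriented a ≡ oriented b → Orbit rev a b
  oriented⇒orbit a b eq with oriented-ends a | oriented-ends b
  ... | inj₁ p | inj₁ q = subst (Orbit rev a) (ends-injective {a} {b} (trans (sym p) (trans eq q))) ε
  ... | inj₁ p | inj₂ q =
    subst (λ c → Orbit rev c b) (sym (ends-injective {a} {rev b} (trans (sym p) (trans eq q)))) (rev-involutive b ◅ ε)
  ... | inj₂ p | inj₁ q = subst (Orbit rev a) (ends-injective {rev a} {b} (trans (sym p) (trans eq q))) (refl ◅ ε)
  ... | inj₂ p | inj₂ q =
    let r = trans (sym p) (trans eq q) in subst (Orbit rev a) (dart-≡ (cong proj₂ r) (cong proj₁ r)) ε

  edgeClasses : HasClasses (Orbit (rev {G = G})) (length (edgesBelow G n))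
  edgeClasses = hasClasses oriented (edgesBelow! G n) oriented-edge hit
    (λ a b → mk⇔ (oriented⇒orbit a b) orbit⇒oriented)
    where
    hit : ∀ {e} → e ∈ edgesBelow G n → ∃ λ a → oriented a ≡ e
    hit e∈ with u<v , _ , u~v ← proj₂ (∈-filter⁻ (edgeBelow? G n) {xs = allPairs n} e∈) =
      dart _ _ u~v , oriented-increasing _ u<v

  -- A planar proper supergraph would have more than 3n − 6 edges.
  maximal : (∀ v → ∃₂ λ x y → x ≢ y × v ~ x × v ~ y) → length (edgesBelow G n) + 6 ≡ 3 * n →
            ∀ (H : Graph (Fin n)) → G ⊑ H → Planar H → H ⊑ G
  maximal branching count H G⊑H P u v Huv with T? (adj u v)
  ... | yes u~v = u~v
  ... | no  u≁v = contradiction tooMany (ℕ.<⇒≱ (ℕ.≤-reflexive (cong suc (sym count))))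
    where
    module H = Graph H
    branchingᴴ : ∀ v → ∃₂ λ x y → x ≢ y × v H.~ x × v H.~ y
    branchingᴴ v with branching v
    ... | x , y , x≢y , v~x , v~y = x , y , x≢y , G⊑H v x v~x , G⊑H v y v~y
    increasing : ∃₂ λ x y → x < y × x H.~ y × ¬ x ~ y
    increasing with <-cmp u v
    ... | tri< u<v _ _ = u , v , u<v , Huv , u≁v
    ... | tri≈ _ u≡v _ = contradiction Huv (H.~-irrefl u≡v)
    ... | tri> _ _ v<u = v , u , v<u , H.~-sym Huv , u≁v ∘ ~-sym
    tooMany : suc (length (edgesBelow G n)) + 6 ≤ 3 * n
    tooMany with increasing
    ... | x , y , x<y , Hxy , x≁y = EdgeBound.planar-edge-bound P {es = (x , y) ∷ edgesBelow G n} u branchingᴴ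
      (All.map (λ (_ , _ , e~) eq → x≁y (subst (uncurry _~_) (sym eq) e~)) (edgesBelow-ok G n) ∷ edgesBelow! G n)
      ((x<y , Hxy) ∷ All.map (λ (u<v , _ , u~v) → u<v , G⊑H _ _ u~v) (edgesBelow-ok G n))

-- The default d is the successor of the last entry.
after : ∀ {n} → Fin n → Fin n → List (Fin n) → Fin n
after d x []           = d
after d x (y ∷ [])     = d
after d x (y ∷ z ∷ zs) = if ⌊ x ≟ y ⌋ then z else after d x (z ∷ zs)

cyclicAfter : ∀ {n} → Fin n → List (Fin n) → Fin n
cyclicAfter x []       = x
cyclicAfter x (y ∷ ys) = after y x (y ∷ ys)

module _ {A : Set} {R : Rel A 0ℓ} where

  reachable : ∀ {x y xs} → Linked R (x ∷ xs) → y ∈ x ∷ xs → Star R x y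
  reachable _       (here refl)        = ε
  reachable (r ∷ l) (there y∈)         = r ◅ reachable l y∈

  reachEnd : ∀ {x z} xs → Linked R (xs ∷ʳ z) → x ∈ xs → Star R x z
  reachEnd (x ∷ [])      (r ∷ [-]) (here refl) = r ◅ ε
  reachEnd (x ∷ y ∷ xs)  (r ∷ l)   (here refl) = r ◅ reachEnd (y ∷ xs) l (here refl)
  reachEnd (x ∷ y ∷ xs)  (r ∷ l)   (there x∈)  = reachEnd (y ∷ xs) l x∈

  linkedInit : ∀ {z} x xs → Linked R ((x ∷ xs) ∷ʳ z) → Linked R (x ∷ xs)
  linkedInit x []       _       = [-]
  linkedInit x (y ∷ xs) (r ∷ l) = r ∷ linkedInit y xs l

  -- From `x` the chain runs forward to the repeated head at the end, and from the head on to `y`,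
  -- whichever of the two comes first.
  cyclic : ∀ {x y} xs → Linked R (xs ++ take 1 xs) → x ∈ xs → y ∈ xs → Star R x y
  cyclic xs@(z ∷ zs) l x∈ y∈ = reachEnd xs l x∈ ◅◅ reachable (linkedInit z zs l) y∈

select : {A : Set} → Bool → Bool → A → A → A → A
select true  _     x y z = x
select false true  x y z = y
select false false x y z = z

select-cases : ∀ {A : Set} b c (x y z : A) →
               select b c x y z ≡ x ⊎ select b c x y z ≡ y ⊎ select b c x y z ≡ z
select-cases true  _     x y z = inj₁ refl
select-cases false true  x y z = inj₂ (inj₁ refl)
select-cases false false x y z = inj₂ (inj₂ refl)

-- Applied to the face permutation of a concrete graph; keeping f abstract prevents Agda from unfolding it.
module _ {A B : Set} (f : A → A) (f³ : ∀ a → f (f (f a)) ≡ a) (label code : A → B)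
         (label-f : ∀ a → label (f a) ≡ label a)
         (label-cases : ∀ a → label a ≡ code a ⊎ label a ≡ code (f a) ⊎ label a ≡ code (f (f a)))
         (code-injective : ∀ {a b} → code a ≡ code b → a ≡ b)
         where

  -- The label is the code of one of `a`, `f a` and `f (f a)`; `f³` provides the way back to `a`.
  leaderOf : ∀ a → ∃ λ b → label a ≡ code b × Orbit f a b × Orbit f b a
  leaderOf a with label-cases a
  ... | inj₁ p        = a , p , ε , ε
  ... | inj₂ (inj₁ p) = f a , p , refl ◅ ε , refl ◅ f³ a ◅ ε
  ... | inj₂ (inj₂ p) = f (f a) , p , refl ◅ refl ◅ ε , f³ a ◅ ε

  orbit⇒label : ∀ {a b} → Orbit f a b → label a ≡ label b
  orbit⇒label ε = refl
  orbit⇒label {a} (refl ◅ s) = trans (sym (label-f a)) (orbit⇒label s)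

  label⇒orbit : ∀ a b → label a ≡ label b → Orbit f a b
  label⇒orbit a b eq with leaderOf a | leaderOf b
  ... | c , p , a→c , _ | d , q , _ , d→b =
    a→c ◅◅ subst (λ e → Orbit f e b) (code-injective (trans (sym q) (trans (sym eq) p))) d→b

  triangleClasses : ∀ {keys} → Unique keys → (∀ a → label a ≡ code a → code a ∈ keys) →
                    (∀ {b} → b ∈ keys → ∃ λ a → label a ≡ b) → HasClasses (Orbit f) (length keys)
  triangleClasses {keys} keys! leader∈ hit = hasClasses label keys! label∈ hit
    (λ a b → mk⇔ (label⇒orbit a b) orbit⇒label)
    where
    label∈ : ∀ a → label a ∈ keys
    label∈ a with leaderOf a
    ... | b , p , a→b , _ = subst (_∈ keys) (sym p) (leader∈ b (trans (sym (orbit⇒label a→b)) p))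

module _ {n : ℕ} where
  open DecMembership (_≟_ {n}) public using (_∈?_)

-- Triangulated embeddings given by neighbour lists

module Rotations {n : ℕ} (rot : Fin n → List (Fin n)) where

  -- The face to the right of the dart u → v continues with v → third u v.
  third : Fin n → Fin n → Fin n
  third u v = cyclicAfter u (rot v)

  -- The dart of the face of u → v that leaves the least vertex, provided that the face is a triangle.
  leader : Fin n → Fin n → Fin n × Fin n
  leader u v = select (does ((u <? v) ×-dec (u <? third u v))) (does ((v <? u) ×-dec (v <? third u v)))
    (u , v) (v , third u v) (third u v , u)

  leader-cases : ∀ u v → leader u v ≡ (u , v) ⊎ leader u v ≡ (v , third u v) ⊎ leader u v ≡ (third u v , u)
  leader-cases u v = select-cases (does ((u <? v) ×-dec (u <? third u v))) (does ((v <? u) ×-dec (v <? third u v))) _ _ _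

  -- The fourth condition closes the face walk after three darts. The last, checked for all darts,
  -- makes the leader constant on each face.
  Corner : Fin n → Fin n → Set
  Corner u v = u ≢ v × u ∈ rot v × third u v ∈ rot v × third v (third u v) ≡ u × leader u v ≡ leader v (third u v)

  corner? : ∀ u v → Dec (Corner u v)
  corner? u v = ¬? (u ≟ v) ×-dec (u ∈? rot v) ×-dec (third u v ∈? rot v) ×-dec (third v (third u v) ≟ u)
    ×-dec ≡-dec _≟_ _≟_ (leader u v) (leader v (third u v))

  IsLeader : Pred (Fin n × Fin n) 0ℓ
  IsLeader (u , v) = v ∈ rot u × leader u v ≡ (u , v)

  isLeader? : Decidable IsLeader
  isLeader? (u , v) = (v ∈? rot u) ×-dec ≡-dec _≟_ _≟_ (leader u v) (u , v)

  leaders : List (Fin n × Fin n)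
  leaders = filter isLeader? (allPairs n)

  -- The second condition makes each list one cycle of the successor map and yields `next-cyclic`;
  -- the third leaves no vertex isolated; the last yields connectedness by descent to vertex 0.
  Consistent : Set
  Consistent = (∀ u → All (Corner u) (rot u))
    × (∀ u → Linked (λ v w → third v u ≡ w) (rot u ++ take 1 (rot u)))
    × (∀ u → 1 ≤ length (rot u))
    × (∀ u → toℕ u ≡ 0 ⊎ Any (_< u) (rot u))

  consistent? : Dec Consistent
  consistent? = all? (λ u → All.all? (corner? u) (rot u))
    ×-dec all? (λ u → linked? (λ v w → third v u ≟ w) (rot u ++ take 1 (rot u)))
    ×-dec all? (λ u → 1 ℕ.≤? length (rot u))
    ×-dec all? (λ u → (toℕ u ℕ.≟ 0) ⊎-dec Any.any? (_<? u) (rot u))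

  module Embedding (consistent : Consistent) where

    corner : ∀ {u v} → v ∈ rot u → Corner u v
    corner = All.lookup (proj₁ consistent _)

    ∈-sym : ∀ {u v} → v ∈ rot u → u ∈ rot v
    ∈-sym v∈ = proj₁ (proj₂ (corner v∈))

    graph : Graph (Fin n)
    graph = record
      { adj      = λ u v → ⌊ v ∈? rot u ⌋
      ; ~-sym    = λ u~v → fromWitness (∈-sym (toWitness u~v))
      ; ~-irrefl = λ u≡v u~v → proj₁ (corner (toWitness u~v)) u≡v
      }

    open Graph graph
    open Dart {G = graph}

    third-∈ : ∀ {u v} → v ∈ rot u → third u v ∈ rot v
    third-∈ v∈ = proj₁ (proj₂ (proj₂ (corner v∈)))

    third² : ∀ {u v} → v ∈ rot u → third v (third u v) ≡ u
    third² v∈ = proj₁ (proj₂ (proj₂ (proj₂ (corner v∈))))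

    third³ : ∀ {u v} → v ∈ rot u → third (third u v) u ≡ v
    third³ {u} {v} v∈ = trans (cong (third (third u v)) (sym (third² v∈))) (third² (third-∈ v∈))

    third≢ : ∀ {u v} → v ∈ rot u → u ≢ third u v
    third≢ {u} {v} v∈ = proj₁ (corner (subst (_∈ rot (third u v)) (third² v∈) (third-∈ (third-∈ v∈)))) ∘ sym

    neighbour : ∀ u → ∃ λ v → v ∈ rot u
    neighbour u with rot u | proj₁ (proj₂ (proj₂ consistent)) u
    ... | v ∷ _ | _ = v , here refl

    branching : ∀ u → ∃₂ λ x y → x ≢ y × u ~ x × u ~ y
    branching u with neighbour u
    ... | v , v∈ = v , third v u , third≢ (∈-sym v∈) , fromWitness v∈ , fromWitness (third-∈ (∈-sym v∈))

    -- As faces are triangles, the neighbour preceding `w` around `u` is the third vertex of the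
    -- face of `u → w`, so the inverse of the rotation is again given by `third`.
    next prev : Dart graph → Dart graph
    next (dart u v u~v) = dart u (third v u) (fromWitness (third-∈ (∈-sym (toWitness u~v))))
    prev (dart u w u~w) = dart u (third u w) (~-sym (fromWitness
      (subst (_∈ rot (third u w)) (third² (toWitness u~w)) (third-∈ (third-∈ (toWitness u~w))))))

    rotationSystem : RotationSystem graph
    rotationSystem = record
      { rotation    = mk↔ₛ′ next prev
          (λ b → dart-≡ refl (third³ (toWitness (src~tgt b))))
          (λ a → dart-≡ refl (third² (∈-sym (toWitness (src~tgt a)))))
      ; next-src    = λ _ → refl
      ; next-cyclic = λ { a (dart _ _ q) refl →
          lift a q (cyclic (rot (src a)) (proj₁ (proj₂ consistent) (src a)) (toWitness (src~tgt a)) (toWitness q)) }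
      }
      where
      lift : ∀ a {w} (q : src a ~ w) → Star (λ v w → third v (src a) ≡ w) (tgt a) w → Orbit next a (dart (src a) w q)
      lift a q ε = subst (Orbit next a) (dart-≡ refl refl) ε
      lift a q (refl ◅ s) = refl ◅ lift (next a) q s

    open RotationSystem rotationSystem using (face)

    face³ : ∀ a → face (face (face a)) ≡ a
    face³ a = dart-≡ (third² (toWitness (src~tgt a)))
      (trans (cong (third (third (src a) (tgt a))) (third² (toWitness (src~tgt a)))) (third³ (toWitness (src~tgt a))))

    label : Dart graph → Fin n × Fin n
    label a = leader (src a) (tgt a)

    label-face : ∀ a → label (face a) ≡ label a
    label-face a = sym (proj₂ (proj₂ (proj₂ (proj₂ (corner (toWitness (src~tgt a)))))))

    label-cases : ∀ a → label a ≡ ends a ⊎ label a ≡ ends (face a) ⊎ label a ≡ ends (face (face a))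
    label-cases a = Sum.map₂ (Sum.map₂ (λ p → trans p
      (cong (third (src a) (tgt a) ,_) (sym (third² (toWitness (src~tgt a))))))) (leader-cases (src a) (tgt a))

    -- Each triangle has exactly one dart that is its own leader, so the number of faces can be
    -- evaluated as the length of a filtered list.
    faceClasses : HasClasses (Orbit face) (length leaders)
    faceClasses = triangleClasses face face³ label ends label-face label-cases ends-injective
      (Unique.filter⁺ isLeader? (allPairs! n))
      (λ a eq → ∈-filter⁺ isLeader? (∈-allPairs _) (toWitness (src~tgt a) , eq))
      (λ e∈ → let v∈ , eq = proj₂ (∈-filter⁻ isLeader? {xs = allPairs n} e∈) in dart _ _ (fromWitness v∈) , eq)

    -- Descent through ever smaller neighbours; `m` bounds the current vertex and makes the
    -- recursion structural.
    toRoot : ∀ m u → toℕ u ≤ m → ∃ λ r → toℕ r ≡ 0 × Star _~_ u r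
    toRoot m u u≤m with proj₂ (proj₂ (proj₂ consistent)) u
    ... | inj₁ u≡0 = u , u≡0 , ε
    ... | inj₂ below with find below
    toRoot zero    u u≤m | inj₂ below | v , v∈ , v<u = contradiction (ℕ.<-≤-trans v<u u≤m) λ ()
    toRoot (suc m) u u≤m | inj₂ below | v , v∈ , v<u with toRoot m v (ℕ.s≤s⁻¹ (ℕ.<-≤-trans v<u u≤m))
    ... | r , r≡0 , v→r = r , r≡0 , fromWitness v∈ ◅ v→r

    connected : Connected graph
    connected u v with toRoot _ u ℕ.≤-refl | toRoot _ v ℕ.≤-refl
    ... | r , r≡0 , u→r | s , s≡0 , v→s with refl ← toℕ-injective {i = r} {s} (trans r≡0 (sym s≡0)) =
      u→r ◅◅ Star.reverse ~-sym v→s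

    planar : Fin n → n + length leaders ≡ length (edgesBelow graph n) + 2 → Planar graph
    planar v₀ euler = record
      { rotationSystem = rotationSystem
      ; vertices   = src , (λ u → let v , v∈ = neighbour u in dart u v (fromWitness v∈) , refl) , (λ _ _ → mk⇔ id id)
      ; edges      = edgeClasses
      ; faces      = faceClasses
      ; components = (λ _ → zero {0}) , (λ { zero → let v , v∈ = neighbour v₀ in dart v₀ v (fromWitness v∈) , refl })
                   , (λ a b → mk⇔ (λ _ → connected (src a) (src b)) (λ _ → refl))
      ; euler      = euler
      }

    planarTriangulation : Fin n → n + length leaders ≡ length (edgesBelow graph n) + 2 →
                          length (edgesBelow graph n) + 6 ≡ 3 * n → PlanarTriangulation graph
    planarTriangulation v₀ euler count = planar v₀ euler , maximal {G = graph} branching count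

-- Double wheels

allSubsets? : ∀ {n} {P : Pred (Subset n) 0ℓ} → Decidable P → Dec (∀ S → P S)
allSubsets? {zero}  P? = map′ (λ { p [] → p }) (λ f → f []) (P? [])
allSubsets? {suc n} P? = map′ (λ { (f , g) (outside ∷ S) → f S ; (f , g) (inside ∷ S) → g S })
                              (λ f → (λ S → f (outside ∷ S)) , (λ S → f (inside ∷ S)))
                              (allSubsets? (P? ∘ (outside ∷_)) ×-dec allSubsets? (P? ∘ (inside ∷_)))

-- Decidable properties of concrete graphs

module _ {n} (G : Graph (Fin n)) where
  open Graph G

  hamiltonianPath? : ∀ vs → Dec (IsHamiltonianPath G vs)
  hamiltonianPath? vs = linked? (λ u v → T? (adj u v)) vs ×-dec DecUnique.unique? _≟_ vs ×-dec all? (_∈? vs)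

  module _ (S : Subset n) where

    Grows : List (Fin n) → Pred (Fin n) 0ℓ
    Grows R v = v ∉ S × ¬ v ∈ R × Any (_~ v) R

    grows? : ∀ R → Decidable (Grows R)
    grows? R v = ¬? (v Subset.∈? S) ×-dec ¬? (v ∈? R) ×-dec Any.any? (λ u → T? (adj u v)) R

    sweep : List (Fin n) → List (Fin n) → List (Fin n)
    sweep R []       = R
    sweep R (v ∷ vs) = sweep (if does (grows? R v) then v ∷ R else R) vs

    ReachableFrom : ∀ {r} → r ∉ S → Pred (Fin n) 0ℓ
    ReachableFrom r∉S v = Σ[ v∉S ∈ v ∉ S ] Star (Graph._~_ (G - S)) (_ , r∉S) (v , v∉S)

    -- A vertex is added only next to one already reached, which extends a path by one edge. That
    -- the sweep exhausts the graph is left to evaluating `spans?`.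
    sweep-sound : ∀ {r} (r∉S : r ∉ S) {R} → All (ReachableFrom r∉S) R → ∀ vs → All (ReachableFrom r∉S) (sweep R vs)
    sweep-sound r∉S reached [] = reached
    sweep-sound r∉S {R} reached (v ∷ vs) = sweep-sound r∉S (extend (grows? R v)) vs
      where
      extend : (g : Dec (Grows R v)) → All (ReachableFrom r∉S) (if does g then v ∷ R else R)
      extend (no _)                  = reached
      extend (yes (v∉S , _ , near)) with find near
      ... | u , u∈R , u~v = (v∉S , proj₂ (All.lookup reached u∈R) ◅◅ u~v ◅ ε) ∷ reached

    -- Sweeping up and down exhausts every path whose vertices are numbered monotonically.
    reach : Fin n → List (Fin n)
    reach r = sweep (r ∷ []) (allFin n ++ reverse (allFin n))

    reach-sound : ∀ {r v} (r∉S : r ∉ S) → v ∈ reach r → ReachableFrom r∉S v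
    reach-sound r∉S = All.lookup (sweep-sound r∉S ((r∉S , ε) ∷ []) (allFin n ++ reverse (allFin n)))

    Spans : List (Fin n) → Set
    Spans R = ∀ v → v ∉ S → v ∈ R

    spans? : ∀ R → Dec (Spans R)
    spans? R = all? λ v → ¬? (v Subset.∈? S) →-dec (v ∈? R)

    spans⇒connected : (∃ λ r → r ∉ S × Spans (reach r)) → Connected (G - S)
    spans⇒connected (r , r∉S , spans) (u , u∉S) (v , v∉S) =
      Star.reverse ~-sym (proj₂ (reach-sound r∉S (spans u u∉S))) ◅◅ proj₂ (reach-sound r∉S (spans v v∉S))

  -- One suitable root for each triple is enough, since paths from the root can be reversed.
  Inseparable : Set
  Inseparable = ∀ S → ∣ S ∣ ≡ 3 → ∃ λ r → r ∉ S × Spans S (reach S r)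

  inseparable? : Dec Inseparable
  inseparable? = allSubsets? λ S → (∣ S ∣ ℕ.≟ 3) →-dec any? λ r → ¬? (r Subset.∈? S) ×-dec spans? S (reach S r)

  inseparable⇒4-connected : 5 ≤ n → Inseparable → FourConnected G
  inseparable⇒4-connected 5≤n i = 5≤n , λ S ∣S∣≡3 → spans⇒connected S (i S ∣S∣≡3)

  -- Equivalently, the vertices numbered `b` and above are pairwise non-adjacent, as the stacked
  -- ones are.
  Covered : ℕ → Set
  Covered b = ∀ u v → u < v → u ~ v → toℕ u ℕ.< b

  covered? : ∀ b → Dec (Covered b)
  covered? b = all? λ u → all? λ v → (u <? v) →-dec T? (adj u v) →-dec (toℕ u ℕ.<? b)

-- Double wheel with hubs 0 and k + 1 and rim 1, …, k; the vertex a i is stacked into the face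
-- 0, c i, c (i + 1) and b i into the face k + 1, c i, c (i + 1).  Neighbours are listed anticlockwise
-- in the drawing with 0 at the centre and k + 1 at infinity.
rotation : ∀ k .{{_ : NonZero k}} → ℕ → List ℕ
rotation k x =
  if x ≡ᵇ 0 then concatMap (λ i → c i ∷ a i ∷ []) (upTo k)
  else if x ≤ᵇ k then around (x ∸ 1)
  -- Around the hub at infinity the rim is met in the opposite sense, hence `downFrom`.
  else if x ≡ᵇ k + 1 then concatMap (λ i → c (1 + i) ∷ b i ∷ []) (downFrom k)
  else if x ≤ᵇ 2 * k + 1 then 0 ∷ c x⁻ ∷ c (1 + x⁻) ∷ []
  else k + 1 ∷ c (1 + x⁻) ∷ c x⁻ ∷ []
  where
  c a b : ℕ → ℕ
  c i = 1 + i % k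
  a i = k + 2 + i % k
  b i = 2 * k + 2 + i % k
  x⁻ : ℕ
  -- This is `i` for `a i` and `k + i` for `b i`; `c` reduces both modulo `k`.
  x⁻ = x ∸ (k + 2)
  around : ℕ → List ℕ
  -- `i + k ∸ 1` stands for i - 1 modulo `k` and avoids truncation at `i = 0`.
  around i = k + 1 ∷ b i ∷ c (i + 1) ∷ a i ∷ 0 ∷ a (i + k ∸ 1) ∷ c (i + k ∸ 1) ∷ b (i + k ∸ 1) ∷ []

-- N = k + 2 keeps no stacked vertex, N = 2k + 2 keeps the a i, and N = 3k + 2 keeps all of them.
wheel : ∀ k .{{_ : NonZero k}} N → Fin N → List (Fin N)
wheel k N u = mapMaybe (λ x → Maybe.map (λ x<N → fromℕ< x<N) (dec⇒maybe (x ℕ.<? N))) (rotation k (toℕ u))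

-- The three triangulations

consistent₉ : Rotations.Consistent (wheel 7 9)
consistent₉ = from-yes (Rotations.consistent? (wheel 7 9))

consistent₂₀ : Rotations.Consistent (wheel 9 20)
consistent₂₀ = from-yes (Rotations.consistent? (wheel 9 20))

consistent₃₅ : Rotations.Consistent (wheel 11 35)
consistent₃₅ = from-yes (Rotations.consistent? (wheel 11 35))

module W₉  = Rotations.Embedding (wheel 7 9) consistent₉
module W₂₀ = Rotations.Embedding (wheel 9 20) consistent₂₀
module W₃₅ = Rotations.Embedding (wheel 11 35) consistent₃₅

fourConnected₉ : FourConnected W₉.graph
fourConnected₉ = inseparable⇒4-connected W₉.graph (from-yes (5 ℕ.≤? 9))
  (toWitness {a? = inseparable? W₉.graph} _)

hamiltonian₂₀ : Hamiltonian W₂₀.graph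
hamiltonian₂₀ = _ , from-yes (hamiltonianPath? W₂₀.graph
  -- The path runs from the outer hub 10 around the rim, alternating between `c i` and `a i`, and
  -- ends at hub 0, a neighbour of the last stacked vertex 19.
  (map (_mod 20) (10 ∷ concatMap (λ i → 1 + i ∷ 11 + i ∷ []) (upTo 9) ++ 0 ∷ [])))

-- The counting inequality is 45 < 46 here, and 84 < 85 and 135 < 136 for the other two graphs. The
-- difference is always exactly one, so `ℕ.≤-refl` proves it.
indecomposable₉ : ¬ Decomposable 2 1 W₉.graph
indecomposable₉ = indecomposable {G = W₉.graph} 9 zero
  (λ {u} {v} → from-yes (covered? W₉.graph 9) u v) ℕ.≤-refl

indecomposable₂₀ : ¬ Decomposable 2 2 W₂₀.graph
indecomposable₂₀ = indecomposable {G = W₂₀.graph} 11 zero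
  (λ {u} {v} → from-yes (covered? W₂₀.graph 11) u v) ℕ.≤-refl

indecomposable₃₅ : ¬ Decomposable 2 3 W₃₅.graph
indecomposable₃₅ = indecomposable {G = W₃₅.graph} 13 zero
  (λ {u} {v} → from-yes (covered? W₃₅.graph 13) u v) ℕ.≤-refl

theorem1p4 : (Σ[ n ∈ ℕ ] Σ[ G ∈ Graph (Fin n) ] (PlanarTriangulation G × FourConnected G × ¬ Decomposable 2 1 G))
    × (Σ[ n ∈ ℕ ] Σ[ G ∈ Graph (Fin n) ] (PlanarTriangulation G × Hamiltonian G × ¬ Decomposable 2 2 G))
    × (Σ[ n ∈ ℕ ] Σ[ G ∈ Graph (Fin n) ] (PlanarTriangulation G × ¬ Decomposable 2 3 G))
theorem1p4 =
  -- The two `refl` evaluate Euler's formula and the edge count: 9 + 14 = 21 + 2 and 21 + 6 = 27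
  -- here, then 20 + 36 = 54 + 2 and 54 + 6 = 60, and finally 35 + 66 = 99 + 2 and 99 + 6 = 105.
  (9 , W₉.graph , W₉.planarTriangulation zero refl refl , fourConnected₉ , indecomposable₉) ,
  (20 , W₂₀.graph , W₂₀.planarTriangulation zero refl refl , hamiltonian₂₀ , indecomposable₂₀) ,
  (35 , W₃₅.graph , W₃₅.planarTriangulation zero refl refl , indecomposable₃₅)
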